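{- Let $\mathcal{C}$ be a finite set, let $\mathcal{R}$ be a finite family of subsets (rows) of $\mathcal{C}$, let $K\subseteq\mathcal{R}$ be an overlap class of $\mathcal{R}$, and let $R_{i_1},R_{i_2},\ldots,R_{i_k}$ be a swap overlap order of the rows of $K$. Then the swap partitioning run on $R_{i_1},R_{i_2},\ldots,R_{i_k}$ fails if and only if $K$ does not verify the consecutive ones property.
   Context: **Consecutive ones property (C1P).** A family of subsets of $\mathcal{C}$ verifies the C1P if there is a permutation (linear ordering) $P$ of $\mathcal{C}$ such that every set of the family is an interval of $P$ (its elements are consecutive in $P$). An overlap class verifies the C1P if the family of its rows does. **Overlap.** Two sets $A,B$ overlap if $A\cap B\neq\emptyset$, $A\setminus B\neq\emptyset$ and $B\setminus A\neq\emptyset$. An overlap class of $\mathcal{R}$ is a connected component of the graph whose vertices are the rows of $\mathcal{R}$ and whose edges join overlapping rows. **Swap overlap order.** A swap overlap order of an overlap class with $k$ rows is an enumeration $R_{i_1},\ldots,R_{i_k}$ of its rows, each appearing once, such that for every $2\le l\le k$ at least one of the following holds: - $R_{i_l}$ overlaps $R_{i_g}$ for some $1\le g<l$; - $l<k$, $R_{i_{l+1}}$ overlaps $R_{i_g}$ for some $1\le g<l$, and $R_{i_l}$ overlaps $R_{i_{l+1}}$. **Refinement of an ordered partition by a row.** One maintains an ordered sequence $P=(C_1)(C_2)\cdots(C_p)$ of nonempty pairwise disjoint subsets of $\mathcal{C}$, called parts. Let $R$ be a row that overlaps at least one row already used to build $P$, and let $Y=R\cap(C_1\cup\cdots\cup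 C_p)$. A part $C$ is touched if $C\cap R\neq\emptyset$ and fully touched if $C\subseteq R$. Splitting a part $C$ means replacing it, at its place in the sequence, by $(C\cap R)(C\setminus R)$ or $(C\setminus R)(C\cap R)$ (empty sets are omitted); the order of the other parts is unchanged. - Case $Y=R$: the refinement succeeds if and only if the touched parts are consecutive in $P$ and all touched parts, except possibly the leftmost and the rightmost touched ones, are fully touched. In that case the leftmost touched part $C$ is split into $(C\setminus R)(C\cap R)$ and the rightmost touched part $C'$ is split into $(C'\cap R)(C'\setminus R)$, so that the elements of $R$ occupy consecutive parts. - Case $Y\neq R$: the refinement succeeds if and only if, for one of the two extremities (left or right) of $P$, the touched parts are consecutive starting from that extremity and all of them are fully touched, except possibly the one farthest from that extremity. In that case the farthest touched part is split with its touched elements placed on the side of that extremity, and a new part $(R\setminus Y)$ is added at that extremity, before all parts if it is the left one and after all parts if it is the right one. (If both extremities are possible, either one may be chosen.) If the refinement does not succeed, it fails. **Swap partitioning.** Start with the partition with the single part $(R_{i_1})$, then process the rows in the order $R_{i_2},R_{i_3},\ldots$ as follows. When the next row to process is $R_{i_j}$: if $R_{i_j}$ overlaps some row already used in the partitioning, refine the current partition by $R_{i_j}$ and go on to $R_{i_{j+1}}$. Otherwise swap $R_{i_j}$ and $R_{i_{j+1}}$: refine the current partition first by $R_{i_{j+1}}$, then by $R_{i_j}$, and go on to $R_{i_{j+2}}$. The swap partitioning fails if one of these refinements fails. -}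

module Defs where

import Data.Bool.Properties as Bool
open import Data.Bool using (if_then_else_)
open import Data.Fin using (Fin; toℕ; _≤_; _<_)
open import Data.Fin.Permutation using (Permutation′; _⟨$⟩ʳ_)
open import Data.Fin.Properties using (all?; _≤?_; _<?_)
open import Data.Fin.Subset using (Subset; Nonempty; _∈_; _⊆_; _∩_; _─_; ⋃)
open import Data.Fin.Subset.Properties using (nonempty?; _⊆?_)
open import Data.List using (List; []; _∷_; _++_; [_]; length; lookup; reverse)
import Data.List.Membership.Propositional as List
open import Data.List.Relation.Unary.Any using (any?)
open import Data.List.Relation.Unary.Unique.Propositional using (Unique)
open import Data.Maybe using (Maybe; just; nothing; _>>=_)
open import Data.Nat as ℕ using (ℕ; suc)
open import Data.Product using (∃; ∃-syntax; _×_; proj₁)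
open import Data.Sum using (_⊎_)
open import Data.Vec.Functional using (Vector)
open import Data.Vec.Properties using (≡-dec)
open import Function using (_∘_; _on_)
open import Function.Bundles using (_⇔_)
open import Relation.Binary using (Rel; Decidable; DecidableEquality)
open import Relation.Binary.Construct.Closure.ReflexiveTransitive using (Star)
open import Relation.Binary.PropositionalEquality using (_≡_)
open import Relation.Nullary using (Dec; does)
open import Relation.Nullary.Decidable using (_×-dec_; _→-dec_)

private
  variable
    n m p : ℕ

------------------------------------------------------------------------
-- Overlap classes and the consecutive ones property

Overlaps : Rel (Subset n) _
Overlaps A B = Nonempty (A ∩ B) × Nonempty (A ─ B) × Nonempty (B ─ A)

overlaps? : Decidable (Overlaps {n})
overlaps? A B = nonempty? (A ∩ B) ×-dec nonempty? (A ─ B) ×-dec nonempty? (B ─ A)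

-- The vertices are the indices of the rows, so equal rows with distinct
-- indices are allowed.  Overlap is symmetric, hence Star is connectedness.
OverlapClass : Vector (Subset n) m → Subset m → Set
OverlapClass rows K = ∃[ i ] (∀ j → j ∈ K ⇔ Star (Overlaps on rows) i j)

Consecutive : (Fin p → Set) → Set
Consecutive Q = ∀ i j k → i ≤ j → j ≤ k → Q i → Q k → Q j

-- P ⟨$⟩ʳ i is the element at position i of the ordering P.
C1P : {I : Set} → (I → Subset n) → Set
C1P {n} F = ∃[ P ] ∀ i → Consecutive {n} (λ j → (P ⟨$⟩ʳ j) ∈ F i)

ClassC1P : Vector (Subset n) m → Subset m → Set
ClassC1P rows K = C1P {I = ∃[ i ] i ∈ K} (rows ∘ proj₁)

record SwapOverlapOrder (rows : Vector (Subset n) m) (K : Subset m)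
                        (order : List (Fin m)) : Set where
  R : Fin (length order) → Subset _
  R = rows ∘ lookup order

  OverlapsBefore : Fin (length order) → Fin (length order) → Set
  OverlapsBefore j l = ∃[ g ] g < l × Overlaps (R j) (R g)

  field
    unique      : Unique order
    enumerates  : ∀ i → i List.∈ order ⇔ i ∈ K
    -- positions count from 0, so the first row is excluded by 0 < toℕ l
    overlapping : ∀ l → 0 ℕ.< toℕ l →
      OverlapsBefore l l ⊎
      (∃[ l⁺ ] toℕ l⁺ ≡ suc (toℕ l) × OverlapsBefore l⁺ l × Overlaps (R l) (R l⁺))

------------------------------------------------------------------------
-- Refinement of an ordered partition

Partition : ℕ → Set
Partition n = List (Subset n)

Touched : Subset n → Subset n → Set
Touched R C = Nonempty (C ∩ R)

touched? : Decidable (Touched {n})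
touched? R C = nonempty? (C ∩ R)

_≟ˢ_ : DecidableEquality (Subset n)
_≟ˢ_ = ≡-dec Bool._≟_

infixr 5 _∷⁺_

_∷⁺_ : Subset n → Partition n → Partition n
C ∷⁺ P = if does (nonempty? C) then C ∷ P else P

-- The leftmost touched part C becomes (C ─ R)(C ∩ R).
splitLeftmost : Subset n → Partition n → Partition n
splitLeftmost R []      = []
splitLeftmost R (C ∷ P) =
  if does (touched? R C) then (C ─ R) ∷⁺ (C ∩ R) ∷⁺ P else C ∷ splitLeftmost R P

-- The rightmost touched part C becomes (C ∩ R)(C ─ R).
splitRightmost : Subset n → Partition n → Partition n
splitRightmost R P = reverse (splitLeftmost R (reverse P))

module _ (R : Subset n) (P : Partition n) where

  TouchedAt FullyTouchedAt : Fin (length P) → Set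
  TouchedAt      i = Touched R (lookup P i)
  FullyTouchedAt i = lookup P i ⊆ R

  touchedAt? : ∀ i → Dec (TouchedAt i)
  touchedAt? i = touched? R (lookup P i)

  fullyTouchedAt? : ∀ i → Dec (FullyTouchedAt i)
  fullyTouchedAt? i = lookup P i ⊆? R

  InnerRefinable : Set
  InnerRefinable =
    Consecutive TouchedAt ×
    (∀ i j k → i < j → j < k → TouchedAt i → TouchedAt j → TouchedAt k → FullyTouchedAt j)

  innerRefinable? : Dec InnerRefinable
  innerRefinable? =
    (all? λ i → all? λ j → all? λ k →
      i ≤? j →-dec j ≤? k →-dec touchedAt? i →-dec touchedAt? k →-dec touchedAt? j)
    ×-dec
    (all? λ i → all? λ j → all? λ k →
      i <? j →-dec j <? k →-dec
      touchedAt? i →-dec touchedAt? j →-dec touchedAt? k →-dec fullyTouchedAt? j)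

data Side : Set where
  left right : Side

opposite : Side → Side
opposite left  = right
opposite right = left

Closer : Side → Rel (Fin p) _
Closer left  i j = i < j
Closer right i j = j < i

closer? : ∀ s → Decidable (Closer {p} s)
closer? left  i j = i <? j
closer? right i j = j <? i

module _ (s : Side) (R : Subset n) (P : Partition n) where

  OuterRefinable : Set
  OuterRefinable =
    (∀ i j → Closer s i j → TouchedAt R P j → TouchedAt R P i) ×
    (∀ i j → Closer s i j → TouchedAt R P i → TouchedAt R P j → FullyTouchedAt R P i)

  outerRefinable? : Dec OuterRefinable
  outerRefinable? =
    (all? λ i → all? λ j →
      closer? s i j →-dec touchedAt? R P j →-dec touchedAt? R P i)
    ×-dec
    (all? λ i → all? λ j →
      closer? s i j →-dec touchedAt? R P i →-dec touchedAt? R P j →-dec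
      fullyTouchedAt? R P i)

outerRefinement : Side → Subset n → Partition n → Partition n
outerRefinement left  R P = (R ─ (R ∩ ⋃ P)) ∷ splitRightmost R P
outerRefinement right R P = splitLeftmost R P ++ [ R ─ (R ∩ ⋃ P) ]

-- `nothing` is failure.  The side s is the extremity to choose when both are
-- possible; it is irrelevant otherwise.
refine : Side → Subset n → Partition n → Maybe (Partition n)
refine s R P =
  if does ((R ∩ ⋃ P) ≟ˢ R)
  then (if does (innerRefinable? R P)
        then just (splitRightmost R (splitLeftmost R P))
        else nothing)
  else (if does (outerRefinable? s R P)
        then just (outerRefinement s R P)
        else if does (outerRefinable? (opposite s) R P)
        then just (outerRefinement (opposite s) R P)
        else nothing)

------------------------------------------------------------------------
-- Swap partitioning

-- choose l is the extremity to choose (when there is a choice) in the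
-- refinement made after l rows have been used; every way of resolving the
-- choices in a run arises from some such function.
module _ (choose : ℕ → Side) where

  -- The first argument lists the rows already used to build the partition.
  mutual
    process : List (Subset n) → Partition n → List (Subset n) → Maybe (Partition n)
    process used P []       = just P
    process used P (R ∷ Rs) =
      if does (any? (overlaps? R) used)
      then (refine (choose (length used)) R P >>= λ P′ → process (R ∷ used) P′ Rs)
      else processSwapped used P R Rs

    processSwapped : List (Subset n) → Partition n → Subset n → List (Subset n) →
                     Maybe (Partition n)
    -- The procedure is undefined here; a swap overlap order never leads here.
    processSwapped used P R []        = nothing
    processSwapped used P R (R′ ∷ Rs) =
      refine (choose (length used)) R′ P >>= λ P′ →
      refine (choose (suc (length used))) R P′ >>= λ P″ →
      process (R ∷ R′ ∷ used) P″ Rs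

  swapPartitioning : List (Subset n) → Maybe (Partition n)
  swapPartitioning []       = just []
  swapPartitioning (R ∷ Rs) = process [ R ] (R ∷⁺ []) Rs

Fails : Maybe (Partition n) → Set
Fails result = result ≡ nothing

-- Let T be a binary relation on the elements.  Call T compatible with an
-- ordered partition P if T never relates an element of a part to an element of
-- an earlier part and the union of P is convex for T.
--
-- If refining P by R yields P′, every T compatible with P′ is compatible with P
-- and makes R convex.  This needs no property of T.  For T the order of the
-- part indices it shows that success yields the consecutive ones property;
-- for T the relation "in the same part" it shows that every used row is a
-- union of parts.
--
-- Conversely, if T is total and compatible with P, R is convex for T and R
-- overlaps a used row, then the refinement succeeds and T or its converse is
-- compatible with the result.
--
-- Everything about the right extremity transfers to the left one by reversing
-- both P and T.

module Submission where

open import Defs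
open import Data.Bool using (if_then_else_)
open import Data.Fin using (Fin; zero; suc; toℕ; cast; _≤_; _<_; _≟_)
open import Data.Fin.Permutation
  using (Permutation′; _⟨$⟩ʳ_; _⟨$⟩ˡ_; _∘ₚ_; cast-id; inverseʳ)
import Data.Fin.Properties as Fin
open import Data.Fin.Subset
  using (Subset; Nonempty; inside; outside; _∈_; _∉_; _∩_; _─_; ⋃)
open import Data.Fin.Subset.Properties
  using (_∈?_; nonempty?; x∈p∩q⁺; x∈p∩q⁻; x∈p∪q⁺; x∈p∪q⁻; x∈p∧x∉q⇒x∈p─q; p─q⊆p; p∩q⊆p;
         ⊆-antisym; ∉⊥)
open import Data.List using (List; []; _∷_; [_]; _++_; map; reverse; lookup; length; allFin)
open import Data.List.Membership.Propositional using (find)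
open import Data.List.Membership.Propositional.Properties using (∈-lookup)
open import Data.List.Properties
  using (unfold-reverse; reverse-involutive; reverse-++; length-tabulate; lookup-tabulate)
open import Data.List.Relation.Binary.Permutation.Propositional
  using (_↭_; prep; swap; ↭-refl; ↭-sym; ↭-trans; ↭⇒↭ₛ)
open import Data.List.Relation.Binary.Permutation.Propositional.Properties
  using (All-resp-↭; ↭-reverse; ↭-length; shift; ∷↭∷ʳ)
open import Data.List.Relation.Binary.Subset.Propositional using () renaming (_⊆_ to _⊆ˡ_)
open import Data.List.Relation.Binary.Subset.Propositional.Properties using (Any-resp-⊆; ∷⁺ʳ)
open import Data.List.Relation.Unary.All as All using (All; []; _∷_)
import Data.List.Relation.Unary.All.Properties as All
open import Data.List.Relation.Unary.Any as Any using (Any; here; there)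
import Data.List.Relation.Unary.Any.Properties as Any
open import Data.List.Relation.Unary.Sorted.TotalOrder.Properties using (lookup-mono-≤)
import Data.List.Sort as Sort
open import Data.Maybe using (Maybe; just; nothing; _>>=_)
open import Data.Nat as ℕ using (ℕ; zero; suc)
import Data.Nat.Properties as ℕ
open import Data.Product using (_×_; _,_; proj₁; proj₂; ∃-syntax; map₂)
open import Data.Sum as Sum using (_⊎_; inj₁; inj₂)
open import Data.Vec using (_∷_; here; there)
open import Data.Vec.Functional using (Vector)
open import Function using (_∘_; id; flip)
open import Function.Bundles using (_⇔_; mk⇔; Equivalence)
open import Level using (0ℓ)
open import Relation.Binary using (Rel; Total; DecTotalOrder; tri<; tri≈; tri>)
open import Relation.Binary.Construct.Closure.ReflexiveTransitive using (ε)
import Relation.Binary.Construct.On as On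
open import Relation.Binary.PropositionalEquality
  using (_≡_; _≢_; refl; sym; trans; cong; setoid; subst; subst₂)
open import Relation.Nullary using (¬_; Dec; yes; no; does; contradiction)
open import Relation.Unary using (Pred)

private
  variable
    n : ℕ
    x y z w : Fin n
    C R A : Subset n
    P : Partition n
    T : Rel (Fin n) 0ℓ

-- Ordered partitions seen through their elements

Covered : Partition n → Pred (Fin n) 0ℓ
Covered P x = Any (x ∈_) P

Together : Partition n → Rel (Fin n) 0ℓ
Together P x y = Any (λ C → x ∈ C × y ∈ C) P

data Before {n} : Partition n → Rel (Fin n) 0ℓ where
  here  : x ∈ C → Covered P y → Before (C ∷ P) x y
  there : Before P x y → Before (C ∷ P) x y

-- An element belonging to parts at two different positions is exactly one that lies before itself.
Disjoint : Partition n → Set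
Disjoint P = ∀ {x} → ¬ Before P x x

Convex : Rel (Fin n) 0ℓ → Pred (Fin n) 0ℓ → Set
Convex T Q = ∀ {x y z} → T x y → T y z → Q x → Q z → Q y

Compatible : Rel (Fin n) 0ℓ → Partition n → Set
Compatible T P = (∀ {x y} → Before P x y → ¬ T y x) × Convex T (Covered P)

x∈p─q⇒x∉q : ∀ (p q : Subset n) → x ∈ p ─ q → x ∉ q
x∈p─q⇒x∉q (_ ∷ p) (inside  ∷ q) (there x∈p─q) (there x∈q) = x∈p─q⇒x∉q p q x∈p─q x∈q
x∈p─q⇒x∉q (_ ∷ p) (outside ∷ q) (there x∈p─q) (there x∈q) = x∈p─q⇒x∉q p q x∈p─q x∈q

x∈p─q⁻ : ∀ (p q : Subset n) → x ∈ p ─ q → x ∈ p × x ∉ q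
x∈p─q⁻ p q x∈p─q = p─q⊆p p q x∈p─q , x∈p─q⇒x∉q p q x∈p─q

∈⋃⁺ : Covered P x → x ∈ ⋃ P
∈⋃⁺ (here x∈C)  = x∈p∪q⁺ (inj₁ x∈C)
∈⋃⁺ (there x∈P) = x∈p∪q⁺ (inj₂ (∈⋃⁺ x∈P))

∈⋃⁻ : ∀ P → x ∈ ⋃ {n} P → Covered P x
∈⋃⁻ []      x∈ = contradiction x∈ ∉⊥
∈⋃⁻ (C ∷ P) x∈ = Sum.[ here , there ∘ ∈⋃⁻ P ] (x∈p∪q⁻ C (⋃ P) x∈)

-- Relations between elements of a partition

covered-first : Before P x y → Covered P x
covered-first (here x∈C _) = here x∈C
covered-first (there b)    = there (covered-first b)

covered-second : Before P x y → Covered P y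
covered-second (here _ y∈P) = there y∈P
covered-second (there b)    = there (covered-second b)

together-coveredˡ : Together P x y → Covered P x
together-coveredˡ = Any.map proj₁

together-sym : Together P x y → Together P y x
together-sym = Any.map λ (x∈C , y∈C) → y∈C , x∈C

compare : Covered P x → Covered P y → Before P x y ⊎ Together P x y ⊎ Before P y x
compare (here x∈C)  (here y∈C)  = inj₂ (inj₁ (here (x∈C , y∈C)))
compare (here x∈C)  (there y∈P) = inj₁ (here x∈C y∈P)
compare (there x∈P) (here y∈C)  = inj₂ (inj₂ (here y∈C x∈P))
compare (there x∈P) (there y∈P) = Sum.map there (Sum.map there there) (compare x∈P y∈P)

-- The index of the first part containing the element. An element outside all parts gets the value
-- `length P`, so comparing a rank with `length P` decides coverage.
rank : Partition n → Fin n → ℕ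
rank []      x = 0
rank (C ∷ P) x = if does (x ∈? C) then 0 else suc (rank P x)

rank-here : x ∈ C → rank (C ∷ P) x ≡ 0
rank-here {x = x} {C = C} x∈C with x ∈? C
... | yes _  = refl
... | no x∉C = contradiction x∈C x∉C

rank-there : x ∉ C → rank (C ∷ P) x ≡ suc (rank P x)
rank-there {x = x} {C = C} x∉C with x ∈? C
... | yes x∈C = contradiction x∈C x∉C
... | no _    = refl

disjoint-tail : Disjoint (C ∷ P) → Disjoint P
disjoint-tail d b = d (there b)

disjoint-head : Disjoint (C ∷ P) → Covered P x → x ∉ C
disjoint-head d x∈P x∈C = d (here x∈C x∈P)

rank-before : Disjoint P → Before P x y → rank P x ℕ.< rank P y
rank-before {P = C ∷ P} d (here x∈C y∈P)
  rewrite rank-here {P = P} x∈C | rank-there {P = P} (disjoint-head d y∈P) = ℕ.z<s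
rank-before {P = C ∷ P} d (there b)
  rewrite rank-there {P = P} (disjoint-head d (covered-first b))
        | rank-there {P = P} (disjoint-head d (covered-second b)) =
  ℕ.s<s (rank-before (disjoint-tail d) b)

rank-together : Disjoint P → Together P x y → rank P x ≡ rank P y
rank-together {P = C ∷ P} d (here (x∈C , y∈C)) =
  trans (rank-here {P = P} x∈C) (sym (rank-here {P = P} y∈C))
rank-together {P = C ∷ P} d (there t)
  rewrite rank-there {P = P} (disjoint-head d (together-coveredˡ t))
        | rank-there {P = P} (disjoint-head d (together-coveredˡ (together-sym t))) =
  cong suc (rank-together (disjoint-tail d) t)

covered⇒rank<length : Covered P x → rank P x ℕ.< length P
covered⇒rank<length {P = C ∷ P} {x = x} x∈P with x ∈? C | x∈P
... | yes _  | _         = ℕ.z<s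
... | no x∉C | here x∈C  = contradiction x∈C x∉C
... | no _   | there x∈P = ℕ.s<s (covered⇒rank<length x∈P)

rank<length⇒covered : ∀ P → rank P x ℕ.< length P → Covered P x
rank<length⇒covered {x = x} (C ∷ P) r<l with x ∈? C
... | yes x∈C = here x∈C
... | no _    = there (rank<length⇒covered P (ℕ.s<s⁻¹ r<l))

before-asym : Disjoint P → Before P x y → ¬ Before P y x
before-asym d b b′ = ℕ.<-asym (rank-before d b) (rank-before d b′)

before⇒¬together : Disjoint P → Before P x y → ¬ Together P x y
before⇒¬together d b t = ℕ.<-irrefl (rank-together d t) (rank-before d b)

together-before : Disjoint P → Together P x y → Before P y z → Before P x z
together-before {P = P} {z = z} d t b with compare (together-coveredˡ t) (covered-second b)
... | inj₁ b′        = b′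
... | inj₂ (inj₁ t′) = contradiction (rank-before d b)
  (ℕ.<-irrefl (trans (sym (rank-together d t)) (rank-together d t′)))
... | inj₂ (inj₂ b′) = contradiction (rank-before d b)
  (ℕ.<-asym (subst (rank P z ℕ.<_) (rank-together d t) (rank-before d b′)))

before-together : Disjoint P → Before P x y → Together P y z → Before P x z
before-together {P = P} {x = x} d b t
  with compare (covered-first b) (together-coveredˡ (together-sym t))
... | inj₁ b′        = b′
... | inj₂ (inj₁ t′) = contradiction (rank-before d b)
  (ℕ.<-irrefl (trans (rank-together d t′) (sym (rank-together d t))))
... | inj₂ (inj₂ b′) = contradiction (rank-before d b)
  (ℕ.<-asym (subst (ℕ._< rank P x) (sym (rank-together d t)) (rank-before d b′)))

-- Uncovered elements have the largest rank, so the union of the parts is an initial segment of the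
-- rank order and hence convex.
rank-compatible : Disjoint P → Compatible (λ x y → rank P x ℕ.≤ rank P y) P
rank-compatible {P = P} d =
  (λ b → ℕ.<⇒≱ (rank-before d b)) ,
  (λ _ y≤z _ z∈P → rank<length⇒covered P (ℕ.≤-<-trans y≤z (covered⇒rank<length z∈P)))

-- Being in a common part with anything already means being covered, which settles convexity. This
-- instance later shows that used rows are unions of parts.
together-compatible : Disjoint P → Compatible (Together P) P
together-compatible d =
  (λ b t → before⇒¬together d b (together-sym t)) , (λ t _ _ _ → together-coveredˡ (together-sym t))

-- Reversal

before-++ʳ : ∀ P {Q} → Covered P x → Covered Q y → Before {n} (P ++ Q) x y
before-++ʳ (C ∷ P) (here x∈C)  y∈Q = here x∈C (Any.++⁺ʳ P y∈Q)
before-++ʳ (C ∷ P) (there x∈P) y∈Q = there (before-++ʳ P x∈P y∈Q)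

before-++ˡ : ∀ {Q} → Before P x y → Before {n} (P ++ Q) x y
before-++ˡ (here x∈C y∈P) = here x∈C (Any.++⁺ˡ y∈P)
before-++ˡ (there b)      = there (before-++ˡ b)

before-∷ʳ⁻ : ∀ P → Before {n} (P ++ [ C ]) x y → Before P x y ⊎ (Covered P x × y ∈ C)
before-∷ʳ⁻ []      (here _ ())
before-∷ʳ⁻ []      (there ())
before-∷ʳ⁻ (D ∷ P) (here x∈D y∈) with Any.++⁻ P y∈
... | inj₁ y∈P        = inj₁ (here x∈D y∈P)
... | inj₂ (here y∈C) = inj₂ (here x∈D , y∈C)
before-∷ʳ⁻ (D ∷ P) (there b) =
  Sum.map there (λ (x∈P , y∈C) → there x∈P , y∈C) (before-∷ʳ⁻ P b)

before-reverse⁺ : Before P x y → Before (reverse P) y x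
before-reverse⁺ {P = C ∷ P} b rewrite unfold-reverse C P with b
... | here x∈C y∈P = before-++ʳ (reverse P) (Any.reverse⁺ y∈P) (here x∈C)
... | there b′     = before-++ˡ (before-reverse⁺ b′)

before-reverse⁻ : ∀ P → Before {n} (reverse P) x y → Before P y x
before-reverse⁻ P b = subst (λ Q → Before Q _ _) (reverse-involutive P) (before-reverse⁺ b)

disjoint-reverse : Disjoint P → Disjoint (reverse P)
disjoint-reverse {P = P} d b = d (before-reverse⁻ P b)

nonempty-reverse : All Nonempty P → All Nonempty (reverse P)
nonempty-reverse {P = P} = All-resp-↭ (↭-sym (↭-reverse P))

compatible-reverse⁺ : Compatible T P → Compatible (flip T) (reverse P)
compatible-reverse⁺ {P = P} (order , convex) =
  (λ b → order (before-reverse⁻ P b)) ,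
  (λ y≤x z≤y x∈P z∈P →
     Any.reverse⁺ (convex z≤y y≤x (Any.reverse⁻ z∈P) (Any.reverse⁻ x∈P)))

compatible-reverse⁻ : Compatible T (reverse P) → Compatible (flip T) P
compatible-reverse⁻ {P = P} c =
  subst (Compatible _) (reverse-involutive P) (compatible-reverse⁺ c)

-- The effect of splitting

-- Each branch is analysed with the evidence for its decision at hand, while the motive `Q` keeps
-- track of the whole conditional.
if-elim : ∀ {ℓ} {B D : Set} (Q : D → Set ℓ) (b? : Dec B) {u v} →
          (B → Q u) → (¬ B → Q v) → Q (if does b? then u else v)
if-elim Q (yes b) qu qv = qu b
if-elim Q (no ¬b) qu qv = qv ¬b

-- An empty head is dropped by `∷⁺`, so a witness found in the head has to show that the head is
-- nonempty.
∷⁺-any⁺ : ∀ {Q : Pred (Subset n) 0ℓ} → (Q C → Nonempty C) → Any Q (C ∷ P) → Any Q (C ∷⁺ P)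
∷⁺-any⁺ {C = C} ne q with nonempty? C | q
... | yes _ | q       = q
... | no ∅C | here qC = contradiction (ne qC) ∅C
... | no _  | there q = q

∷⁺-any⁻ : ∀ {Q : Pred (Subset n) 0ℓ} → Any Q (C ∷⁺ P) → Any Q (C ∷ P)
∷⁺-any⁻ {C = C} q with nonempty? C
... | yes _ = q
... | no _  = there q

∷⁺-before⁺ : Before (C ∷ P) x y → Before (C ∷⁺ P) x y
∷⁺-before⁺ {C = C} b with nonempty? C | b
... | yes _ | b        = b
... | no ∅C | here x∈C _ = contradiction (_ , x∈C) ∅C
... | no _  | there b  = b

∷⁺-before⁻ : Before (C ∷⁺ P) x y → Before (C ∷ P) x y
∷⁺-before⁻ {C = C} b with nonempty? C
... | yes _ = b
... | no _  = there b

∷⁺-nonempty : All Nonempty P → All Nonempty (C ∷⁺ P)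
∷⁺-nonempty {C = C} nes with nonempty? C
... | yes ne = ne ∷ nes
... | no _   = nes

-- Records where the split takes place: an element of the split part has no element of `R` in any
-- earlier part.
Leftmost : Subset n → Partition n → Pred (Fin n) 0ℓ
Leftmost R P x = ∀ {w} → w ∈ R → Covered P w → Together P x w ⊎ Before P x w

splitHead : Subset n → Subset n → Partition n → Partition n
splitHead R C P = (C ─ R) ∷⁺ (C ∩ R) ∷⁺ P

splitHead-covered⁺ : ∀ R C P → Covered (C ∷ P) x → Covered {n} (splitHead R C P) x
splitHead-covered⁺ {x = x} R C P (there x∈P) =
  ∷⁺-any⁺ (x ,_) (there (∷⁺-any⁺ (x ,_) (there x∈P)))
splitHead-covered⁺ {x = x} R C P (here x∈C) with x ∈? R
... | yes x∈R = ∷⁺-any⁺ (x ,_) (there (∷⁺-any⁺ (x ,_) (here (x∈p∩q⁺ (x∈C , x∈R)))))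
... | no x∉R  = ∷⁺-any⁺ (x ,_) (here (x∈p∧x∉q⇒x∈p─q x∈C x∉R))

splitHead-covered⁻ : ∀ R C P → Covered {n} (splitHead R C P) x → Covered (C ∷ P) x
splitHead-covered⁻ R C P x∈ with ∷⁺-any⁻ {C = C ─ R} x∈
... | here x∈C─R = here (p─q⊆p C R x∈C─R)
... | there x∈ with ∷⁺-any⁻ {C = C ∩ R} x∈
...   | here x∈C∩R = here (proj₁ (x∈p∩q⁻ C R x∈C∩R))
...   | there x∈P  = there x∈P

splitHead-together⁻ : ∀ R C P → Together {n} (splitHead R C P) x y → Together (C ∷ P) x y
splitHead-together⁻ R C P t with ∷⁺-any⁻ {C = C ─ R} t
... | here (x∈ , y∈) = here (p─q⊆p C R x∈ , p─q⊆p C R y∈)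
... | there t with ∷⁺-any⁻ {C = C ∩ R} t
...   | here (x∈ , y∈) = here (proj₁ (x∈p∩q⁻ C R x∈) , proj₁ (x∈p∩q⁻ C R y∈))
...   | there t        = there t

splitHead-before⁺ : ∀ R C P → Before (C ∷ P) x y → Before {n} (splitHead R C P) x y
splitHead-before⁺ R C P (there b) = ∷⁺-before⁺ (there (∷⁺-before⁺ (there b)))
splitHead-before⁺ {x = x} {y = y} R C P (here x∈C y∈P) with x ∈? R
... | yes x∈R = ∷⁺-before⁺ (there (∷⁺-before⁺ (here (x∈p∩q⁺ (x∈C , x∈R)) y∈P)))
... | no x∉R  = ∷⁺-before⁺ (here (x∈p∧x∉q⇒x∈p─q x∈C x∉R) (∷⁺-any⁺ (y ,_) (there y∈P)))

-- The only new pairs lead from `C ─ R` to `C ∩ R`. Their first element is `Leftmost` because `C` is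
-- the head of the sequence.
splitHead-before⁻ : ∀ R C P → Before {n} (splitHead R C P) x y →
                    Before (C ∷ P) x y ⊎ (x ∉ R × y ∈ R × Leftmost R (C ∷ P) x)
splitHead-before⁻ R C P b with ∷⁺-before⁻ {C = C ─ R} b
... | here x∈C─R y∈ with x∈p─q⁻ C R x∈C─R | ∷⁺-any⁻ {C = C ∩ R} y∈
...   | x∈C , x∉R | there y∈P  = inj₁ (here x∈C y∈P)
...   | x∈C , x∉R | here y∈C∩R = inj₂ (x∉R , proj₂ (x∈p∩q⁻ C R y∈C∩R) , λ where
  _ (here w∈C)  → inj₁ (here (x∈C , w∈C))
  _ (there w∈P) → inj₂ (here x∈C w∈P))
splitHead-before⁻ R C P _ | there b with ∷⁺-before⁻ {C = C ∩ R} b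
...   | here x∈C∩R y∈P = inj₁ (here (proj₁ (x∈p∩q⁻ C R x∈C∩R)) y∈P)
...   | there b        = inj₁ (there b)

split-elim : ∀ R C P (Q : Partition n → Set) →
             (Touched R C → Q (splitHead R C P)) →
             (¬ Touched R C → Q (C ∷ splitLeftmost R P)) →
             Q (splitLeftmost R (C ∷ P))
split-elim R C P Q = if-elim Q (touched? R C)

split-covered⁺ : ∀ R P → Covered P x → Covered {n} (splitLeftmost R P) x
split-covered⁺ {x = x} R (C ∷ P) x∈ =
  split-elim R C P (λ P′ → Covered P′ x) (λ _ → splitHead-covered⁺ R C P x∈) λ _ → tail x∈
  where
  tail : Covered (C ∷ P) x → Covered (C ∷ splitLeftmost R P) x
  tail (here x∈C)  = here x∈C
  tail (there x∈P) = there (split-covered⁺ R P x∈P)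

split-covered⁻ : ∀ R P → Covered {n} (splitLeftmost R P) x → Covered P x
split-covered⁻ {x = x} R (C ∷ P) =
  split-elim R C P (λ P′ → Covered P′ x → _) (λ _ → splitHead-covered⁻ R C P) λ _ → λ where
    (here x∈C) → here x∈C
    (there x∈) → there (split-covered⁻ R P x∈)

split-together⁻ : ∀ R P → Together {n} (splitLeftmost R P) x y → Together P x y
split-together⁻ {x = x} {y = y} R (C ∷ P) =
  split-elim R C P (λ P′ → Together P′ x y → _) (λ _ → splitHead-together⁻ R C P) λ _ → λ where
    (here t)  → here t
    (there t) → there (split-together⁻ R P t)

split-before⁺ : ∀ R P → Before P x y → Before {n} (splitLeftmost R P) x y
split-before⁺ {x = x} {y = y} R (C ∷ P) b =
  split-elim R C P (λ P′ → Before P′ x y) (λ _ → splitHead-before⁺ R C P b) λ _ → tail b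
  where
  tail : Before (C ∷ P) x y → Before (C ∷ splitLeftmost R P) x y
  tail (here x∈C y∈P) = here x∈C (split-covered⁺ R P y∈P)
  tail (there b)      = there (split-before⁺ R P b)

split-before⁻ : ∀ R P → Before {n} (splitLeftmost R P) x y →
                Before P x y ⊎ (x ∉ R × y ∈ R × Leftmost R P x)
split-before⁻ {x = x} {y = y} R (C ∷ P) =
  split-elim R C P
    (λ P′ → Before P′ x y → Before (C ∷ P) x y ⊎ (x ∉ R × y ∈ R × Leftmost R (C ∷ P) x))
    (λ _ → splitHead-before⁻ R C P) λ ¬t → λ where
    (here x∈C y∈) → inj₁ (here x∈C (split-covered⁻ R P y∈))
    (there b)     → Sum.map there (λ (x∉R , y∈R , l) → x∉R , y∈R , λ where
      -- The skipped part is untouched, so it adds no element of `R` in front.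
      w∈R (here w∈C)  → contradiction (_ , x∈p∩q⁺ (w∈C , w∈R)) ¬t
      w∈R (there w∈P) → Sum.map there there (l w∈R w∈P)) (split-before⁻ R P b)

-- The common part of `x` and `y` is touched, by `x`. Either it is the one that is split, and then
-- `y` ends up on the left of `x`, or an earlier part is split, and that touched part supplies `w`.
split-separates : ∀ R P → Together {n} P x y → x ∈ R → y ∉ R →
                  Before (splitLeftmost R P) y x ⊎ (∃[ w ] w ∈ R × Before P w y)
split-separates {x = x} {y = y} R (C ∷ P) t x∈R y∉R =
  split-elim R C P (λ P′ → Before P′ y x ⊎ (∃[ w ] w ∈ R × Before (C ∷ P) w y))
    (λ w → head w t) λ ¬t → tail ¬t t
  where
  head : Touched R C → Together (C ∷ P) x y →
         Before (splitHead R C P) y x ⊎ (∃[ w ] w ∈ R × Before (C ∷ P) w y)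
  head _ (here (x∈C , y∈C)) = inj₁ (∷⁺-before⁺ (here (x∈p∧x∉q⇒x∈p─q y∈C y∉R)
    (∷⁺-any⁺ (x ,_) (here (x∈p∩q⁺ (x∈C , x∈R))))))
  head (w , w∈C∩R) (there t) with w∈C , w∈R ← x∈p∩q⁻ C R w∈C∩R =
    inj₂ (w , w∈R , here w∈C (together-coveredˡ (together-sym t)))
  tail : ¬ Touched R C → Together (C ∷ P) x y →
         Before (C ∷ splitLeftmost R P) y x ⊎ (∃[ w ] w ∈ R × Before (C ∷ P) w y)
  tail ¬t (here (x∈C , y∈C)) = contradiction (_ , x∈p∩q⁺ (x∈C , x∈R)) ¬t
  tail _  (there t) =
    Sum.map there (λ (w , w∈R , b) → w , w∈R , there b) (split-separates R P t x∈R y∉R)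

split-disjoint : ∀ R → Disjoint P → Disjoint {n} (splitLeftmost R P)
split-disjoint {P = P} R d b with split-before⁻ R P b
... | inj₁ b               = d b
... | inj₂ (x∉R , x∈R , _) = x∉R x∈R

split-nonempty : ∀ R → All (Nonempty {n}) P → All Nonempty (splitLeftmost R P)
split-nonempty R [] = []
split-nonempty {P = C ∷ P} R (ne ∷ nes) = split-elim R C P (All Nonempty)
  (λ _ → ∷⁺-nonempty (∷⁺-nonempty nes)) (λ _ → ne ∷ split-nonempty R nes)

-- Splitting keeps all old `Before` pairs and the union of the parts, so compatibility only becomes
-- more demanding.
split-compatible⁻ : ∀ R P → Compatible T (splitLeftmost R P) → Compatible T P
split-compatible⁻ R P (order , convex) =
  (λ b → order (split-before⁺ R P b)) ,
  (λ x≤y y≤z x∈P z∈P →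
     split-covered⁻ R P (convex x≤y y≤z (split-covered⁺ R P x∈P) (split-covered⁺ R P z∈P)))

-- The split puts the elements outside `R` on the left of the leftmost touched part. Hence `T x y`
-- keeps `y` out of that part and of all earlier ones.
split-witness : ∀ R P → Compatible T (splitLeftmost R P) → Covered P x → Covered P y →
                x ∈ R → y ∉ R → T x y → ∃[ w ] w ∈ R × Before P w y
split-witness R P (order , _) x∈P y∈P x∈R y∉R x≤y with compare x∈P y∈P
... | inj₁ b        = _ , x∈R , b
... | inj₂ (inj₂ b) = contradiction x≤y (order (split-before⁺ R P b))
... | inj₂ (inj₁ t) with split-separates R P t x∈R y∉R
...   | inj₁ b = contradiction x≤y (order b)
...   | inj₂ w = w

-- A new pair puts some `x ∉ R` before some `y ∈ R`. If `T y x` held, the `z` given by the last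
-- hypothesis would place `x` between two elements of `R`, against convexity.
split-compatible⁺ : ∀ R P → Compatible T P → Convex T (_∈ R) →
                    (∀ {x} → Covered P x → Leftmost R P x → ∃[ z ] z ∈ R × T x z) →
                    Compatible T (splitLeftmost R P)
split-compatible⁺ R P (order , convex) convexR beyond =
  order′ ,
  (λ x≤y y≤z x∈ z∈ →
     split-covered⁺ R P (convex x≤y y≤z (split-covered⁻ R P x∈) (split-covered⁻ R P z∈)))
  where
  order′ : ∀ {x y} → Before (splitLeftmost R P) x y → ¬ _
  order′ b y≤x with split-before⁻ R P b
  ... | inj₁ b = order b y≤x
  ... | inj₂ (x∉R , y∈R , l)
    with z , z∈R , x≤z ← beyond (split-covered⁻ R P (covered-first b)) l =
    x∉R (convexR y≤x x≤z y∈R z∈R)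

before⇒≤ : Total T → Compatible T P → Before P x y → T x y
before⇒≤ total (order , _) b with total _ _
... | inj₁ x≤y = x≤y
... | inj₂ y≤x = contradiction y≤x (order b)

total-flip : Total T → Total (flip T)
total-flip total x y = total y x

-- Refinement by a row contained in the partition

Inside : Subset n → Partition n → Set
Inside R P = ∀ {x} → x ∈ R → Covered P x

-- Element-wise form of `InnerRefinable`. For disjoint nonempty parts it expresses consecutiveness
-- and full touching at once.
Inner : Subset n → Partition n → Set
Inner R P = ∀ {x y z} → Before P x y → Before P y z → x ∈ R → z ∈ R → y ∈ R

-- No single part contains `R`, so that the leftmost and the rightmost touched parts differ. Overlap
-- with a used row will provide this.
Scattered : Subset n → Partition n → Set
Scattered R P = ∀ x → ∃[ w ] w ∈ R × ¬ Together P x w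

innerRefinement : Subset n → Partition n → Partition n
innerRefinement R P = splitRightmost R (splitLeftmost R P)

splitRightmost-compatible⁻ : ∀ R P → Compatible T (splitRightmost R P) → Compatible T P
splitRightmost-compatible⁻ R P c =
  compatible-reverse⁻ (split-compatible⁻ R (reverse P) (compatible-reverse⁻ c))

innerRefinement-convex : Disjoint P → Inside R P → Inner R P →
                         Compatible T (innerRefinement R P) → Convex T (_∈ R)
innerRefinement-convex {P = P} {R = R} {T = T} d R⊆P inner c {x} {y} {z} x≤y y≤z x∈R z∈R
  with y ∈? R
... | yes y∈R = y∈R
... | no y∉R = between
  where
  P₁ : Partition _
  P₁ = splitLeftmost R P

  c₁ : Compatible T P₁
  c₁ = splitRightmost-compatible⁻ R P₁ c

  y∈P : Covered P y
  y∈P = proj₂ (split-compatible⁻ R P c₁) x≤y y≤z (R⊆P x∈R) (R⊆P z∈R)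

  between : y ∈ R
  between
    -- If `y ∉ R`, the left split yields `w ∈ R` in a part before `y`, and the right split, read in
    -- the mirror, yields `v ∈ R` after `y`.
    with w , w∈R , w<y ← split-witness R P c₁ (R⊆P x∈R) y∈P x∈R y∉R x≤y
       | v , v∈R , v<y ← split-witness R (reverse P₁) (compatible-reverse⁻ c)
           (Any.reverse⁺ (split-covered⁺ R P (R⊆P z∈R))) (Any.reverse⁺ (split-covered⁺ R P y∈P))
           z∈R y∉R y≤z
    with split-before⁻ R P (before-reverse⁻ P₁ v<y)
  ... | inj₁ y<v = inner w<y y<v w∈R v∈R
  -- Here `y` precedes `v` only because of the left split, so `y` is in the leftmost touched part,
  -- which the earlier `w` contradicts.
  ... | inj₂ (_ , _ , leftmost) with leftmost w∈R (covered-first w<y)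
  ...   | inj₁ t   = contradiction (together-sym t) (before⇒¬together d w<y)
  ...   | inj₂ y<w = contradiction y<w (before-asym d w<y)

-- Seen from the leftmost touched part, an element of `R` in another part must lie further right,
-- hence above in `T`. This is the bound asked for by `split-compatible⁺`.
splitLeftmost-compatible⁺ : Total T → Compatible T P → Convex T (_∈ R) → Inside R P →
                            Scattered R P → Compatible T (splitLeftmost R P)
splitLeftmost-compatible⁺ {T = T} {P = P} {R = R} total c convexR R⊆P scattered =
  split-compatible⁺ R P c convexR λ {x} _ leftmost → beyond x leftmost
  where
  beyond : ∀ x → Leftmost R P x → ∃[ z ] z ∈ R × T x z
  beyond x leftmost with w , w∈R , ¬t ← scattered x | leftmost w∈R (R⊆P w∈R)
  ... | inj₁ t = contradiction t ¬t
  ... | inj₂ b = w , w∈R , before⇒≤ total c b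

innerRefinement-compatible⁺ : Total T → Compatible T P → Convex T (_∈ R) → Inside R P →
                              Scattered R P → Compatible T (innerRefinement R P)
innerRefinement-compatible⁺ {P = P} {R = R} total c convexR R⊆P scattered =
  compatible-reverse⁺ (splitLeftmost-compatible⁺ (total-flip total)
    (compatible-reverse⁺ (splitLeftmost-compatible⁺ total c convexR R⊆P scattered))
    (λ y≤x z≤y x∈R z∈R → convexR z≤y y≤x z∈R x∈R)
    (λ x∈R → Any.reverse⁺ (split-covered⁺ R P (R⊆P x∈R)))
    -- Splitting merges no parts, so `R` is still scattered when the second split is made.
    λ x → let w , w∈R , ¬t = scattered x in
      w , w∈R , λ t → ¬t (split-together⁻ R P (Any.reverse⁻ t)))

inner-necessary : Total T → Compatible T P → Convex T (_∈ R) → Inner R P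
inner-necessary total c convexR x<y y<z = convexR (before⇒≤ total c x<y) (before⇒≤ total c y<z)

-- Refinement by a row that sticks out of the partition

-- Element-wise form of `OuterRefinable`: membership in `R` propagates towards the extremity where
-- the new part goes.
Outer : Side → Subset n → Partition n → Set
Outer left  R P = ∀ {x y} → Before P x y → y ∈ R → x ∈ R
Outer right R P = ∀ {x y} → Before P x y → x ∈ R → y ∈ R

newPart : Subset n → Partition n → Subset n
newPart R P = R ─ (R ∩ ⋃ P)

∈newPart⁺ : ∀ P → x ∈ R → ¬ Covered {n} P x → x ∈ newPart R P
∈newPart⁺ P x∈R x∉P = x∈p∧x∉q⇒x∈p─q x∈R (x∉P ∘ ∈⋃⁻ P ∘ proj₂ ∘ x∈p∩q⁻ _ _)

∈newPart⁻ : ∀ R P → x ∈ newPart {n} R P → x ∈ R × ¬ Covered P x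
∈newPart⁻ R P x∈ with x∈R , x∉ ← x∈p─q⁻ R (R ∩ ⋃ P) x∈ =
  x∈R , λ x∈P → x∉ (x∈p∩q⁺ (x∈R , ∈⋃⁺ x∈P))

⋃-reverse : ∀ (P : Partition n) → ⋃ (reverse P) ≡ ⋃ P
⋃-reverse P = ⊆-antisym
  (∈⋃⁺ {P = P} ∘ Any.reverse⁻ ∘ ∈⋃⁻ (reverse P))
  (∈⋃⁺ {P = reverse P} ∘ Any.reverse⁺ ∘ ∈⋃⁻ P)

-- Mirror symmetry, by which the right extremity alone needs a direct treatment.
outerRefinement-left : ∀ (R : Subset n) P →
  reverse (outerRefinement right R (reverse P)) ≡ outerRefinement left R P
outerRefinement-left R P
  rewrite reverse-++ (splitLeftmost R (reverse P)) [ newPart R (reverse P) ] | ⋃-reverse P = refl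

outer-left⇒right : Outer left R P → Outer right R (reverse P)
outer-left⇒right {P = P} outer b = outer (before-reverse⁻ P b)

outer-right⇒left : Outer right R (reverse P) → Outer left R P
outer-right⇒left outer b = outer (before-reverse⁺ b)

module _ (R : Subset n) (P : Partition n) where

  private
    P′ : Partition n
    P′ = outerRefinement right R P

  outerRight-covered⁺ : Covered P x ⊎ x ∈ R → Covered P′ x
  outerRight-covered⁺ (inj₁ x∈P) = Any.++⁺ˡ (split-covered⁺ R P x∈P)
  outerRight-covered⁺ {x = x} (inj₂ x∈R) with x ∈? ⋃ P
  ... | yes x∈P = outerRight-covered⁺ (inj₁ (∈⋃⁻ P x∈P))
  ... | no x∉P  = Any.++⁺ʳ (splitLeftmost R P) (here (∈newPart⁺ P x∈R (x∉P ∘ ∈⋃⁺)))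

  outerRight-covered⁻ : Covered P′ x → Covered P x ⊎ (x ∈ R × ¬ Covered P x)
  outerRight-covered⁻ x∈ with Any.++⁻ (splitLeftmost R P) x∈
  ... | inj₁ x∈       = inj₁ (split-covered⁻ R P x∈)
  ... | inj₂ (here x∈) = inj₂ (∈newPart⁻ R P x∈)

  outerRight-before-new : Covered P x → y ∈ R → ¬ Covered P y → Before P′ x y
  outerRight-before-new x∈P y∈R y∉P =
    before-++ʳ (splitLeftmost R P) (split-covered⁺ R P x∈P) (here (∈newPart⁺ P y∈R y∉P))

  outerRight-disjoint : Disjoint P → Disjoint P′
  outerRight-disjoint d b with before-∷ʳ⁻ (splitLeftmost R P) b
  ... | inj₁ b         = split-disjoint R d b
  ... | inj₂ (x∈ , x∈N) = proj₂ (∈newPart⁻ R P x∈N) (split-covered⁻ R P x∈)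

  outerRight-nonempty : x ∈ R → ¬ Covered P x → All Nonempty P → All Nonempty P′
  outerRight-nonempty x∈R x∉P ne =
    All.∷ʳ⁺ (split-nonempty R ne) (_ , ∈newPart⁺ P x∈R x∉P)

  -- The new part follows all of `P`, so `T` relates none of its elements to an element of `P`. This
  -- keeps the union of `P` convex and leaves, for the convexity of `R`, only the case where `x` and
  -- `y` are both covered.
  outerRight-compatible⁻ : Outer right R P → Compatible T P′ → Compatible T P × Convex T (_∈ R)
  outerRight-compatible⁻ {T = T} outer (order , convex) = (proj₁ c , convexP) , convexR
    where
    convexP : Convex T (Covered P)
    convexP x≤y y≤z x∈P z∈P
      with outerRight-covered⁻
        (convex x≤y y≤z (outerRight-covered⁺ (inj₁ x∈P)) (outerRight-covered⁺ (inj₁ z∈P)))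
    ... | inj₁ y∈P         = y∈P
    ... | inj₂ (y∈R , y∉P) = contradiction y≤z (order (outerRight-before-new z∈P y∈R y∉P))

    order₁ : ∀ {x y} → Before (splitLeftmost R P) x y → ¬ T y x
    order₁ b = order (before-++ˡ b)

    convex₁ : Convex T (Covered (splitLeftmost R P))
    convex₁ x≤y y≤z x∈ z∈ =
      split-covered⁺ R P (convexP x≤y y≤z (split-covered⁻ R P x∈) (split-covered⁻ R P z∈))

    c : Compatible T P
    c = split-compatible⁻ R P (order₁ , convex₁)

    convexR : Convex T (_∈ R)
    convexR {y = y} x≤y y≤z x∈R z∈R with y ∈? R
    ... | yes y∈R = y∈R
    ... | no y∉R
      with outerRight-covered⁻
        (convex x≤y y≤z (outerRight-covered⁺ (inj₂ x∈R)) (outerRight-covered⁺ (inj₂ z∈R)))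
    ...   | inj₂ (y∈R , _) = y∈R
    ...   | inj₁ y∈P with outerRight-covered⁻ (outerRight-covered⁺ (inj₂ x∈R))
    ...     | inj₂ (_ , x∉P) = contradiction x≤y (order (outerRight-before-new y∈P x∈R x∉P))
    ...     | inj₁ x∈P
      -- The split puts some `w ∈ R` before `y`, and `outer` carries membership in `R` from `w` to
      -- `y`.
      with w , w∈R , b ← split-witness R P (order₁ , convex₁) x∈P y∈P x∈R y∉R x≤y = outer b w∈R

  -- The witnesses `a` and `u` will come from a used row overlapping `R`, and `v` from the new part.
  -- The relation `T u v` makes the right extremity the correct one: convexity of the union of `P`
  -- forces `v` above all of it.
  module _ {a u v : Fin n} (total : Total T) (c : Compatible T P) (convexR : Convex T (_∈ R))
           (a∈P : Covered P a) (a∉R : a ∉ R) (u∈P : Covered P u) (u∈R : u ∈ R)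
           (v∉P : ¬ Covered P v) (v∈R : v ∈ R) (u≤v : T u v) where

    private
      all≤v : Covered P x → T x v
      all≤v {x = x} x∈P with total x v
      ... | inj₁ x≤v = x≤v
      ... | inj₂ v≤x = contradiction (proj₂ c u≤v v≤x u∈P x∈P) v∉P

    outerRight-necessary : Outer right R P
    outerRight-necessary b x∈R = convexR (before⇒≤ total c b) (all≤v (covered-second b)) x∈R v∈R

    outerRight-compatible⁺ : Compatible T P′
    outerRight-compatible⁺ = order , convex
      where
      c₁ : Compatible T (splitLeftmost R P)
      c₁ = split-compatible⁺ R P c convexR λ x∈P _ → v , v∈R , all≤v x∈P

      -- `R` cannot also stick out on the left: below `a`, `y` would force `a` into `R`; between `a`
      -- and `x`, it would be covered.
      new-last : Covered P x → y ∈ R → ¬ Covered P y → ¬ T y x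
      new-last {y = y} x∈P y∈R y∉P y≤x with total y a
      ... | inj₁ y≤a = a∉R (convexR y≤a (all≤v a∈P) y∈R v∈R)
      ... | inj₂ a≤y = y∉P (proj₂ c a≤y y≤x a∈P x∈P)

      order : ∀ {x y} → Before P′ x y → ¬ T y x
      order b y≤x with before-∷ʳ⁻ (splitLeftmost R P) b
      ... | inj₁ b = proj₁ c₁ b y≤x
      ... | inj₂ (x∈ , y∈N) with y∈R , y∉P ← ∈newPart⁻ R P y∈N =
        new-last (split-covered⁻ R P x∈) y∈R y∉P y≤x

      -- Both the union of `P` and `R` are convex and contain `u`. A point between two elements of
      -- either set is therefore caught on its own side of `u`.
      convex : Convex T (Covered P′)
      convex {y = y} x≤y y≤z x∈ z∈ with total y u
      ... | inj₁ y≤u = outerRight-covered⁺ (Sum.map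
        (λ x∈P → proj₂ c x≤y y≤u x∈P u∈P) (λ (x∈R , _) → convexR x≤y y≤u x∈R u∈R)
        (outerRight-covered⁻ x∈))
      ... | inj₂ u≤y = outerRight-covered⁺ (Sum.map
        (λ z∈P → proj₂ c u≤y y≤z u∈P z∈P) (λ (z∈R , _) → convexR u≤y y≤z u∈R z∈R)
        (outerRight-covered⁻ z∈))

Toward : Side → Rel (Fin n) 0ℓ → Rel (Fin n) 0ℓ
Toward left  T = flip T
Toward right T = T

outer-necessary : ∀ s {a u v : Fin n} → Total T → Compatible T P → Convex T (_∈ R) →
  Covered P a → a ∉ R → Covered P u → u ∈ R → ¬ Covered P v → v ∈ R → Toward s T u v →
  Outer s R P
outer-necessary {P = P} {R = R} right total c convexR a∈P a∉R u∈P u∈R v∉P v∈R u≤v =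
  outerRight-necessary R P total c convexR a∈P a∉R u∈P u∈R v∉P v∈R u≤v
outer-necessary {P = P} {R = R} left total c convexR a∈P a∉R u∈P u∈R v∉P v∈R v≤u =
  outer-right⇒left (outerRight-necessary R (reverse P)
    (total-flip total) (compatible-reverse⁺ c) (λ y≤x z≤y x∈R z∈R → convexR z≤y y≤x z∈R x∈R)
    (Any.reverse⁺ a∈P) a∉R (Any.reverse⁺ u∈P) u∈R (v∉P ∘ Any.reverse⁻) v∈R v≤u)

outer-compatible⁺ : ∀ s {a u v : Fin n} → Total T → Compatible T P → Convex T (_∈ R) →
  Covered P a → a ∉ R → Covered P u → u ∈ R → ¬ Covered P v → v ∈ R → Toward s T u v →
  Compatible T (outerRefinement s R P)
outer-compatible⁺ {P = P} {R = R} right total c convexR a∈P a∉R u∈P u∈R v∉P v∈R u≤v =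
  outerRight-compatible⁺ R P total c convexR a∈P a∉R u∈P u∈R v∉P v∈R u≤v
outer-compatible⁺ {P = P} {R = R} left total c convexR a∈P a∉R u∈P u∈R v∉P v∈R v≤u =
  subst (Compatible _) (outerRefinement-left R P)
    (compatible-reverse⁺ (outerRight-compatible⁺ R (reverse P)
      (total-flip total) (compatible-reverse⁺ c) (λ y≤x z≤y x∈R z∈R → convexR z≤y y≤x z∈R x∈R)
      (Any.reverse⁺ a∈P) a∉R (Any.reverse⁺ u∈P) u∈R (v∉P ∘ Any.reverse⁻) v∈R v≤u))

-- If `a` and `u` were in different parts, one of the two conditions would carry membership in `R`
-- from `u` to `a`. Any further part would receive it from `u` by one condition and pass it on to
-- `a` by the other. So there is only one part.
both-outer⇒¬before : ∀ s {a u : Fin n} → Disjoint P → Covered P a → a ∉ R → Covered P u → u ∈ R →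
                     Outer s R P → Outer (opposite s) R P → ¬ Before P z w
both-outer⇒¬before right d a∈P a∉R u∈P u∈R outerʳ outerˡ =
  both-outer⇒¬before left d a∈P a∉R u∈P u∈R outerˡ outerʳ
both-outer⇒¬before {P = P} {z = z} {w = w} left {a} {u} d a∈P a∉R u∈P u∈R outerˡ outerʳ b
  with compare a∈P u∈P
... | inj₁ a<u        = a∉R (outerˡ a<u u∈R)
... | inj₂ (inj₂ u<a) = a∉R (outerʳ u<a u∈R)
... | inj₂ (inj₁ t)   = neither b
  where
  nothing-after : ¬ Before P a x
  nothing-after a<x = a∉R (outerˡ a<x (outerʳ (together-before d (together-sym t) a<x) u∈R))

  nothing-before : ¬ Before P x a
  nothing-before x<a = a∉R (outerʳ x<a (outerˡ (before-together d x<a t) u∈R))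

  neither : ¬ Before P z w
  neither b with compare a∈P (covered-first b)
  ... | inj₁ a<z        = nothing-after a<z
  ... | inj₂ (inj₁ t)   = nothing-after (together-before d t b)
  ... | inj₂ (inj₂ z<a) = nothing-before z<a

-- Positions of parts

before⇒positions : Before P x y → ∃[ i ] ∃[ j ] i < j × x ∈ lookup P i × y ∈ lookup P j
before⇒positions (here x∈C y∈P) = zero , suc (Any.index y∈P) , ℕ.z<s , x∈C , Any.lookup-index y∈P
before⇒positions (there b) with i , j , i<j , x∈ , y∈ ← before⇒positions b =
  suc i , suc j , ℕ.s<s i<j , x∈ , y∈

positions⇒before : ∀ P {i j} → i < j → x ∈ lookup P i → y ∈ lookup {A = Subset n} P j → Before P x y
positions⇒before (C ∷ P) {zero}  {suc j} _   x∈C y∈ =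
  here x∈C (Any.map (λ { refl → y∈ }) (∈-lookup {xs = P} j))
positions⇒before (C ∷ P) {suc i} {suc j} i<j x∈  y∈ =
  there (positions⇒before P (ℕ.s<s⁻¹ i<j) x∈ y∈)

position-unique : ∀ P {i j} → Disjoint P → x ∈ lookup {A = Subset n} P i → x ∈ lookup P j → i ≡ j
position-unique P {i} {j} d x∈i x∈j with Fin.<-cmp i j
... | tri< i<j _ _ = contradiction (positions⇒before P i<j x∈i x∈j) d
... | tri≈ _ i≡j _ = i≡j
... | tri> _ _ j<i = contradiction (positions⇒before P j<i x∈j x∈i) d

innerRefinable⇒inner : Disjoint P → InnerRefinable R P → Inner R P
innerRefinable⇒inner {P = P} d (consecutive , full) x<y y<z x∈R z∈R
  with i , j , i<j , x∈i , y∈j ← before⇒positions x<y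
     | j′ , k , j<k , y∈j′ , z∈k ← before⇒positions y<z
  -- Disjointness identifies the two positions found for `y`.
  with refl ← position-unique P d y∈j y∈j′ =
  full i j k i<j j<k ti (consecutive i j k (ℕ.<⇒≤ i<j) (ℕ.<⇒≤ j<k) ti tk) tk y∈j
  where
  ti = _ , x∈p∩q⁺ (x∈i , x∈R)
  tk = _ , x∈p∩q⁺ (z∈k , z∈R)

inner⇒innerRefinable : All Nonempty P → Inner R P → InnerRefinable R P
inner⇒innerRefinable {P = P} {R = R} nonempty inner =
  consecutive , λ i j k i<j j<k ti _ tk → full i<j j<k ti tk
  where
  full : ∀ {i j k} → i < j → j < k → TouchedAt R P i → TouchedAt R P k → FullyTouchedAt R P j
  full {i} {j} {k} i<j j<k (x , x∈) (z , z∈) y∈j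
    with x∈i , x∈R ← x∈p∩q⁻ (lookup P i) R x∈ | z∈k , z∈R ← x∈p∩q⁻ (lookup P k) R z∈ =
    inner (positions⇒before P i<j x∈i y∈j) (positions⇒before P j<k y∈j z∈k) x∈R z∈R

  consecutive : Consecutive (TouchedAt R P)
  consecutive i j k i≤j j≤k ti tk with i ≟ j | j ≟ k
  ... | yes refl | _        = ti
  ... | no _     | yes refl = tk
  -- A part contained in `R` counts as touched because it is nonempty.
  ... | no i≢j   | no j≢k with y , y∈j ← All.lookup nonempty (∈-lookup {xs = P} j) =
    y , x∈p∩q⁺ (y∈j , full (Fin.≤∧≢⇒< i≤j i≢j) (Fin.≤∧≢⇒< j≤k j≢k) ti tk y∈j)

outerRefinable⇒outer : ∀ s → OuterRefinable s R P → Outer s R P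
outerRefinable⇒outer left (closed , full) x<y y∈R
  with i , j , i<j , x∈i , y∈j ← before⇒positions x<y =
  full i j i<j (closed i j i<j tj) tj x∈i
  where tj = _ , x∈p∩q⁺ (y∈j , y∈R)
outerRefinable⇒outer right (closed , full) x<y x∈R
  with i , j , i<j , x∈i , y∈j ← before⇒positions x<y =
  full j i i<j (closed j i i<j ti) ti y∈j
  where ti = _ , x∈p∩q⁺ (x∈i , x∈R)

outer⇒outerRefinable : ∀ s → All Nonempty P → Outer s R P → OuterRefinable s R P
outer⇒outerRefinable {P = P} {R = R} s nonempty outer =
  (λ i j i<j tj → let x , x∈i = All.lookup nonempty (∈-lookup {xs = P} i) in
    x , x∈p∩q⁺ (x∈i , full s outer i<j tj x∈i)) ,
  λ i j i<j _ tj → full s outer i<j tj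
  where
  full : ∀ s → Outer s R P → ∀ {i j} → Closer s i j → TouchedAt R P j → FullyTouchedAt R P i
  full left outer {i} {j} i<j (y , y∈) x∈i with y∈j , y∈R ← x∈p∩q⁻ (lookup P j) R y∈ =
    outer (positions⇒before P i<j x∈i y∈j) y∈R
  full right outer {i} {j} j<i (y , y∈) x∈i with y∈j , y∈R ← x∈p∩q⁻ (lookup P j) R y∈ =
    outer (positions⇒before P j<i y∈j x∈i) y∈R

-- A single refinement

-- The invariant of a run. `sound` ranges over all relations, because it is applied both to the rank
-- order and to `Together`; this is what raises the record to `Set₁`.
record Represents (used : List (Subset n)) (P : Partition n) : Set₁ where
  field
    disjoint : Disjoint P
    nonempty : All Nonempty P
    covered  : All (λ A → Inside A P) used
    sound    : ∀ {T} → Compatible T P → All (λ A → Convex T (_∈ A)) used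

open Represents

represents-singleton : ∀ (R : Subset n) → Represents [ R ] (R ∷⁺ [])
represents-singleton R = record
  { disjoint = λ b → disjoint₁ (∷⁺-before⁻ {C = R} b)
  ; nonempty = ∷⁺-nonempty []
  ; covered  = (λ {x} x∈R → ∷⁺-any⁺ (x ,_) (here x∈R)) ∷ []
  ; sound    = λ (_ , convex) → (λ x≤y y≤z x∈R z∈R → covered⁻
      (convex x≤y y≤z (∷⁺-any⁺ (_ ,_) (here x∈R)) (∷⁺-any⁺ (_ ,_) (here z∈R)))) ∷ []
  }
  where
  disjoint₁ : Disjoint [ R ]
  disjoint₁ (here _ ())
  disjoint₁ (there ())

  covered⁻ : Covered (R ∷⁺ []) x → x ∈ R
  covered⁻ x∈ with ∷⁺-any⁻ {C = R} x∈
  ... | here x∈R = x∈R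

compatible-singleton : ∀ (R : Subset n) → Convex T (_∈ R) → Compatible T (R ∷⁺ [])
compatible-singleton {T = T} R convexR = order , convex
  where
  order : ∀ {x y} → Before (R ∷⁺ []) x y → ¬ T y x
  order b with ∷⁺-before⁻ {C = R} b
  ... | here _ ()
  ... | there ()

  convex : Convex T (Covered (R ∷⁺ []))
  convex x≤y y≤z x∈ z∈ with ∷⁺-any⁻ {C = R} x∈ | ∷⁺-any⁻ {C = R} z∈
  ... | here x∈R | here z∈R = ∷⁺-any⁺ (_ ,_) (here (convexR x≤y y≤z x∈R z∈R))

insides-map : ∀ {P′ : Partition n} {used} → (∀ {x} → Covered P x → Covered P′ x) →
              All (λ A → Inside A P) used → All (λ A → Inside A P′) used
insides-map P⊆P′ []           = []
insides-map P⊆P′ (A⊆P ∷ used) = (λ x∈A → P⊆P′ (A⊆P x∈A)) ∷ insides-map P⊆P′ used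

convexes-flip : ∀ {used : List (Subset n)} →
                All (λ A → Convex (flip T) (_∈ A)) used → All (λ A → Convex T (_∈ A)) used
convexes-flip []              = []
convexes-flip (convex ∷ used) = (λ x≤y y≤z x∈ z∈ → convex y≤z x≤y z∈ x∈) ∷ convexes-flip used

module _ {used : List (Subset n)} {P : Partition n} (rep : Represents used P)
         {R : Subset n} where

  represents-inner : Inside R P → InnerRefinable R P → Represents (R ∷ used) (innerRefinement R P)
  represents-inner R⊆P refinable = record
    { disjoint = disjoint-reverse
        (split-disjoint R (disjoint-reverse (split-disjoint R (disjoint rep))))
    ; nonempty = nonempty-reverse
        (split-nonempty R (nonempty-reverse (split-nonempty R (nonempty rep))))
    ; covered  = (λ x∈R → covered⁺ (R⊆P x∈R)) ∷ insides-map covered⁺ (covered rep)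
    ; sound    = λ c →
        innerRefinement-convex (disjoint rep) R⊆P (innerRefinable⇒inner (disjoint rep) refinable) c ∷
        sound rep (split-compatible⁻ R P (splitRightmost-compatible⁻ R (splitLeftmost R P) c))
    }
    where
    covered⁺ : Covered P x → Covered (innerRefinement R P) x
    covered⁺ x∈P = Any.reverse⁺
      (split-covered⁺ R (reverse (splitLeftmost R P)) (Any.reverse⁺ (split-covered⁺ R P x∈P)))

  represents-outerRight : x ∈ R → ¬ Covered P x → Outer right R P →
                          Represents (R ∷ used) (outerRefinement right R P)
  represents-outerRight x∈R x∉P outer = record
    { disjoint = outerRight-disjoint R P (disjoint rep)
    ; nonempty = outerRight-nonempty R P x∈R x∉P (nonempty rep)
    ; covered  = (λ x∈R → outerRight-covered⁺ R P (inj₂ x∈R)) ∷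
                 insides-map (λ x∈P → outerRight-covered⁺ R P (inj₁ x∈P)) (covered rep)
    ; sound    = λ c → let c′ , convexR = outerRight-compatible⁻ R P outer c in
        convexR ∷ sound rep c′
    }

represents-reverse : ∀ {used : List (Subset n)} → Represents used P → Represents used (reverse P)
represents-reverse rep = record
  { disjoint = disjoint-reverse (disjoint rep)
  ; nonempty = nonempty-reverse (nonempty rep)
  ; covered  = insides-map Any.reverse⁺ (covered rep)
  ; sound    = λ c → convexes-flip (sound rep (compatible-reverse⁻ c))
  }

represents-outer : ∀ s {used : List (Subset n)} → Represents used P → x ∈ R → ¬ Covered P x →
                   Outer s R P → Represents (R ∷ used) (outerRefinement s R P)
represents-outer right rep = represents-outerRight rep
represents-outer {P = P} {R = R} left rep x∈R x∉P outer =
  subst (Represents _) (outerRefinement-left R P) (represents-reverse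
    (represents-outerRight (represents-reverse rep) x∈R (x∉P ∘ Any.reverse⁻)
      (outer-left⇒right outer)))

∩⋃≡⇒inside : R ∩ ⋃ P ≡ R → Inside R P
∩⋃≡⇒inside {R = R} {P = P} eq x∈R = ∈⋃⁻ P (proj₂ (x∈p∩q⁻ R (⋃ P) (subst (_ ∈_) (sym eq) x∈R)))

∩⋃≢⇒outside : ∀ (R : Subset n) P → R ∩ ⋃ P ≢ R → ∃[ v ] v ∈ R × ¬ Covered P v
∩⋃≢⇒outside R P neq with nonempty? (newPart R P)
... | yes (v , v∈) = v , ∈newPart⁻ R P v∈
... | no empty = contradiction (⊆-antisym (p∩q⊆p R (⋃ P)) R⊆) neq
  where
  R⊆ : ∀ {x} → x ∈ R → x ∈ R ∩ ⋃ P
  R⊆ {x} x∈R with x ∈? R ∩ ⋃ P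
  ... | yes x∈ = x∈
  ... | no x∉  = contradiction (x , x∈p∧x∉q⇒x∈p─q x∈R x∉) empty

refine-represents : ∀ s {used : List (Subset n)} → Represents used P →
                    ∀ {P′} → refine s R P ≡ just P′ → Represents (R ∷ used) P′
refine-represents {P = P} {R = R} s {used} rep {P′} =
  if-elim Q ((R ∩ ⋃ P) ≟ˢ R)
    (λ eq → if-elim Q (innerRefinable? R P)
      (λ refinable → λ { refl → represents-inner rep (∩⋃≡⇒inside eq) refinable })
      (λ _ ()))
    (λ neq → let v , v∈R , v∉P = ∩⋃≢⇒outside R P neq in
      if-elim Q (outerRefinable? s R P)
        (λ refinable → λ { refl → represents-outer s rep v∈R v∉P
                                    (outerRefinable⇒outer s refinable) })
        (λ _ → if-elim Q (outerRefinable? (opposite s) R P)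
          (λ refinable → λ { refl → represents-outer (opposite s) rep v∈R v∉P
                                      (outerRefinable⇒outer (opposite s) refinable) })
          (λ _ ())))
  where
  Q : Maybe (Partition _) → Set₁
  Q result = result ≡ just P′ → Represents (R ∷ used) P′

toward : ∀ s → Total T → ∀ (x y : Fin n) → Toward s T x y ⊎ Toward (opposite s) T x y
toward left  total x y = total y x
toward right total x y = total x y

toward-flip : ∀ s → Toward (opposite s) T x y → Toward s (flip T) x y
toward-flip left  t = t
toward-flip right t = t

-- A used row `A` overlapping `R` gives `p` in both, `q` only in `R` and `a` only in `A`. In the
-- inner case `p` and `q` show that `R` is scattered; in the outer case the direction of `T` from
-- `p` to an uncovered element of `R` decides the extremity. The converse of `T` appears when both
-- extremities are possible and the other one is chosen.
refine-succeeds : ∀ s {used : List (Subset n)} → Represents used P → Any (Overlaps R) used →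
                  Total T → Compatible T P → Convex T (_∈ R) →
                  ∃[ P′ ] refine s R P ≡ just P′ × (Compatible T P′ ⊎ Compatible (flip T) P′)
refine-succeeds {P = P} {R = R} {T = T} s {used} rep ov total c convexR
  with A , A∈used , (p , p∈R∩A) , (q , q∈R─A) , (a , a∈A─R) ← find ov
  with p∈R , p∈A ← x∈p∩q⁻ R A p∈R∩A
     | q∈R , q∉A ← x∈p─q⁻ R A q∈R─A
     | a∈A , a∉R ← x∈p─q⁻ A R a∈A─R =
  if-elim Q ((R ∩ ⋃ P) ≟ˢ R)
    (λ eq → if-elim Q (innerRefinable? R P)
      (λ _ → _ , refl ,
         inj₁ (innerRefinement-compatible⁺ total c convexR (∩⋃≡⇒inside eq) scattered))
      (contradiction (inner⇒innerRefinable (nonempty rep) (inner-necessary total c convexR))))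
    (λ neq → outer (∩⋃≢⇒outside R P neq))
  where
  Q : Maybe (Partition _) → Set
  Q result = ∃[ P′ ] result ≡ just P′ × (Compatible T P′ ⊎ Compatible (flip T) P′)

  A⊆P : Inside A P
  A⊆P = All.lookup (covered rep) A∈used

  -- A is a union of parts.
  convexA : Convex (Together P) (_∈ A)
  convexA = All.lookup (sound rep (together-compatible (disjoint rep))) A∈used

  scattered : Scattered R P
  scattered x with x ∈? A
  -- If `q` shared a part with `x`, it would lie between `x` and `x` for `Together P`, and convexity
  -- of `A` would put it in `A`.
  ... | yes x∈A = q , q∈R , λ t → q∉A (convexA t (together-sym t) x∈A x∈A)
  ... | no x∉A  = p , p∈R , λ t → x∉A (convexA (together-sym t) t p∈A p∈A)

  outer : ∃[ v ] v ∈ R × ¬ Covered P v →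
          Q (if does (outerRefinable? s R P)
             then just (outerRefinement s R P)
             else if does (outerRefinable? (opposite s) R P)
             then just (outerRefinement (opposite s) R P)
             else nothing)
  outer (v , v∈R , v∉P) = if-elim Q (outerRefinable? s R P) chosen other
    where
    necessary : ∀ s → Toward s T p v → Outer s R P
    necessary s = outer-necessary s total c convexR (A⊆P a∈A) a∉R (A⊆P p∈A) p∈R v∉P v∈R

    compatible : ∀ s → Toward s T p v → Compatible T (outerRefinement s R P)
    compatible s = outer-compatible⁺ s total c convexR (A⊆P a∈A) a∉R (A⊆P p∈A) p∈R v∉P v∈R

    chosen : OuterRefinable s R P → Q (just (outerRefinement s R P))
    chosen refinable with toward s total p v
    ... | inj₁ t = _ , refl , inj₁ (compatible s t)
    -- `T` points away from the chosen extremity, so the converse of `T` is carried on instead.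
    ... | inj₂ t = _ , refl , inj₂ (outer-compatible⁺ s (total-flip total) c-flip
                     (λ y≤x z≤y x∈R z∈R → convexR z≤y y≤x z∈R x∈R)
                     (A⊆P a∈A) a∉R (A⊆P p∈A) p∈R v∉P v∈R (toward-flip s t))
      where
      -- Both extremities are possible only when P has a single part.
      c-flip : Compatible (flip T) P
      c-flip =
        (λ b _ → both-outer⇒¬before s (disjoint rep) (A⊆P a∈A) a∉R (A⊆P p∈A) p∈R
           (outerRefinable⇒outer s refinable) (necessary (opposite s) t) b) ,
        λ y≤x z≤y x∈P z∈P → proj₂ c z≤y y≤x z∈P x∈P

    other : ¬ OuterRefinable s R P →
            Q (if does (outerRefinable? (opposite s) R P)
               then just (outerRefinement (opposite s) R P) else nothing)
    other ¬refinable with toward s total p v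
    ... | inj₁ t = contradiction (outer⇒outerRefinable s (nonempty rep) (necessary s t)) ¬refinable
    ... | inj₂ t = if-elim Q (outerRefinable? (opposite s) R P)
      (λ _ → _ , refl , inj₁ (compatible (opposite s) t))
      (contradiction
        (outer⇒outerRefinable (opposite s) (nonempty rep) (necessary (opposite s) t)))

-- Undoing the swaps

data Chain {n} : List (Subset n) → List (Subset n) → Set where
  []  : ∀ {used} → Chain used []
  _∷_ : ∀ {used Rs} → Any (Overlaps R) used → Chain (R ∷ used) Rs → Chain used (R ∷ Rs)

-- The swap overlap order as a list condition relative to earlier rows. `swapped` consumes only `R`,
-- since `R′` must still meet its own condition with `R` among the earlier rows.
data SwapOrdered {n} : List (Subset n) → List (Subset n) → Set where
  []      : ∀ {used} → SwapOrdered used []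
  direct  : ∀ {used Rs} → Any (Overlaps R) used → SwapOrdered (R ∷ used) Rs →
            SwapOrdered used (R ∷ Rs)
  swapped : ∀ {used R R′ Rs} → Any (Overlaps R′) used → Overlaps R R′ →
            SwapOrdered (R ∷ used) (R′ ∷ Rs) → SwapOrdered used (R ∷ R′ ∷ Rs)

swapOrdered-tail : ∀ {used Rs} → SwapOrdered used (R ∷ Rs) → SwapOrdered (R ∷ used) Rs
swapOrdered-tail (direct _ o)    = o
swapOrdered-tail (swapped _ _ o) = o

swapOrdered-⊆ : ∀ {used used′ Rs} → used ⊆ˡ used′ →
                SwapOrdered {n} used Rs → SwapOrdered used′ Rs
swapOrdered-⊆ sub []              = []
swapOrdered-⊆ sub (direct a o)    = direct (Any-resp-⊆ sub a) (swapOrdered-⊆ (∷⁺ʳ _ sub) o)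
swapOrdered-⊆ sub (swapped a r o) = swapped (Any-resp-⊆ sub a) r (swapOrdered-⊆ (∷⁺ʳ _ sub) o)

module _ {n m} (rows : Vector (Subset n) m) where

  -- The set of earlier rows is divided into those already removed from the list and those still in
  -- it, so that the positional condition passes to tails.
  OverlapsEarlier : List (Subset n) → (xs : List (Fin m)) → Rel (Fin (length xs)) 0ℓ
  OverlapsEarlier used xs j l = Any (Overlaps (rows (lookup xs j))) used ⊎
    (∃[ g ] g < l × Overlaps (rows (lookup xs j)) (rows (lookup xs g)))

  Admissible : List (Subset n) → (xs : List (Fin m)) → Pred (Fin (length xs)) 0ℓ
  Admissible used xs l = OverlapsEarlier used xs l l ⊎
    (∃[ l⁺ ] toℕ l⁺ ≡ suc (toℕ l) × OverlapsEarlier used xs l⁺ l ×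
             Overlaps (rows (lookup xs l)) (rows (lookup xs l⁺)))

  overlapsEarlier-tail : ∀ {used i xs} j {l} → OverlapsEarlier used (i ∷ xs) (suc j) (suc l) →
                         OverlapsEarlier (rows i ∷ used) xs j l
  overlapsEarlier-tail j (inj₁ a)                  = inj₁ (there a)
  overlapsEarlier-tail j (inj₂ (zero  , _   , o)) = inj₁ (here o)
  overlapsEarlier-tail j (inj₂ (suc g , g<l , o)) = inj₂ (g , ℕ.s<s⁻¹ g<l , o)

  overlapsEarlier-first : ∀ {used i xs} j → OverlapsEarlier used (i ∷ xs) j zero →
                          Any (Overlaps (rows (lookup (i ∷ xs) j))) used
  overlapsEarlier-first j (inj₁ a) = a

  admissible-tail : ∀ {used i xs l} → Admissible used (i ∷ xs) (suc l) →
                    Admissible (rows i ∷ used) xs l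
  admissible-tail {xs = _ ∷ _} {l} (inj₁ e) = inj₁ (overlapsEarlier-tail l e)
  admissible-tail {xs = _ ∷ _} (inj₂ (suc l⁺ , eq , e , o)) =
    inj₂ (l⁺ , ℕ.suc-injective eq , overlapsEarlier-tail l⁺ e , o)

  admissible⇒swapOrdered : ∀ {used} xs → (∀ l → Admissible used xs l) →
                           SwapOrdered used (map rows xs)
  admissible⇒swapOrdered []       adm = []
  admissible⇒swapOrdered (i ∷ xs) adm
    with adm zero | admissible⇒swapOrdered xs (λ l → admissible-tail (adm (suc l)))
  ... | inj₁ e | o = direct (overlapsEarlier-first zero e) o
  admissible⇒swapOrdered (i ∷ j ∷ xs) adm | inj₂ (suc zero , _ , e , r) | o =
    swapped (overlapsEarlier-first (suc zero) e) r o

-- Runs of the partitioning with the swaps carried out beforehand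

module _ (choose : ℕ → Side) where

  refineAll : ℕ → Partition n → List (Subset n) → Maybe (Partition n)
  refineAll k P []       = just P
  refineAll k P (R ∷ Rs) = refine (choose k) R P >>= λ P′ → refineAll (suc k) P′ Rs

  >>=-cong : ∀ {A B : Set} {f g : A → Maybe B} r → (∀ x → f x ≡ g x) → (r >>= f) ≡ (r >>= g)
  >>=-cong nothing  f≗g = refl
  >>=-cong (just x) f≗g = f≗g x

  -- Performing the swaps beforehand leaves a list in which every row overlaps an earlier one, and
  -- the run becomes a plain sequence of refinements.
  unswap : ∀ used Rs → SwapOrdered {n} used Rs → ∃[ Rs′ ] Chain used Rs′ × Rs ↭ Rs′ ×
           (∀ P → process choose used P Rs ≡ refineAll (length used) P Rs′)
  unswap used []       o = [] , [] , ↭-refl , λ P → refl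
  unswap used (R ∷ Rs) o with Any.any? (overlaps? R) used
  unswap used (R ∷ Rs) o | yes a
    with Rs′ , chain , perm , run ← unswap (R ∷ used) Rs (swapOrdered-tail o) =
    R ∷ Rs′ , a ∷ chain , prep R perm , λ P → >>=-cong (refine (choose (length used)) R P) run
  unswap used (R ∷ _) (direct a o) | no ¬a = contradiction a ¬a
  unswap used (R ∷ R′ ∷ Rs) (swapped a r o) | no ¬a
    -- The run records the swapped pair in the opposite order; only membership among the used rows
    -- matters.
    with Rs′ , chain , perm , run ← unswap (R ∷ R′ ∷ used) Rs
           (swapOrdered-⊆ (λ { (here e) → there (here e) ; (there (here e)) → here e
                             ; (there (there e)) → there (there e) }) (swapOrdered-tail o)) =
    R′ ∷ R ∷ Rs′ , a ∷ here r ∷ chain , swap R R′ perm ,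
    λ P → >>=-cong (refine (choose (length used)) R′ P)
          λ P′ → >>=-cong (refine (choose (suc (length used))) R P′) run

  refineAll-sound : ∀ k {used Rs} → Represents used P → Chain used Rs →
                    ∀ {P′} → refineAll k P Rs ≡ just P′ →
                    Disjoint P′ ×
                    (∀ {T} → Compatible T P′ → All (λ A → Convex T (_∈ A)) (Rs ++ used))
  refineAll-sound k rep [] refl = disjoint rep , sound rep
  refineAll-sound {P = P} k {used} rep (_∷_ {R = R} {Rs = Rs} a chain) eq
    with refine (choose k) R P in eq₁
  ... | just P₁
    with d , snd ← refineAll-sound (suc k) (refine-represents (choose k) rep eq₁) chain eq =
    d , λ c → All-resp-↭ (shift R Rs used) (snd c)

  -- A step may replace `T` by its converse, but totality and the convexity of the remaining rows
  -- survive this.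
  refineAll-succeeds : ∀ k {used Rs} → Represents used P → Chain used Rs →
                       Total T → Compatible T P → All (λ A → Convex T (_∈ A)) Rs →
                       ∃[ P′ ] refineAll k P Rs ≡ just P′
  refineAll-succeeds k rep []          total c []           = _ , refl
  refineAll-succeeds k rep (a ∷ chain) total c (convex ∷ convexes)
    with P₁ , eq , c₁ ← refine-succeeds (choose k) rep a total c convex
    rewrite eq with c₁
  ... | inj₁ c₁ = refineAll-succeeds (suc k) (refine-represents (choose k) rep eq) chain
                    total c₁ convexes
  ... | inj₂ c₁ = refineAll-succeeds (suc k) (refine-represents (choose k) rep eq) chain
                    (total-flip total) c₁ (convexes-flip convexes)

-- Orderings

-- The permutation reads off the list of all elements sorted by `f`; the casts account for the
-- lengths of the two lists.
sortBy : ∀ (f : Fin n → ℕ) →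
         ∃[ π ] (∀ {i j} → i ≤ j → f (π ⟨$⟩ʳ i) ℕ.≤ f (π ⟨$⟩ʳ j))
sortBy {n} f = π , mono
  where
  module Perm where
    open import Data.List.Relation.Binary.Permutation.Setoid (setoid (Fin n)) public
    open import Data.List.Relation.Binary.Permutation.Setoid.Properties (setoid (Fin n)) public
  order = On.decTotalOrder ℕ.≤-decTotalOrder f
  open DecTotalOrder order using (totalOrder)
  open Sort order

  xs : List (Fin n)
  xs = sort (allFin n)

  xs↭ : xs Perm.↭ allFin n
  xs↭ = ↭⇒↭ₛ (sort-↭ (allFin n))

  len : length (allFin n) ≡ n
  len = length-tabulate id

  eq : n ≡ length xs
  eq = trans (sym len) (sym (↭-length (sort-↭ (allFin n))))

  π : Permutation′ n
  π = cast-id eq ∘ₚ Perm.onIndices xs↭ ∘ₚ cast-id len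

  π-lookup : ∀ i → π ⟨$⟩ʳ i ≡ lookup xs (cast eq i)
  π-lookup i = trans (sym (lookup-tabulate id (π ⟨$⟩ʳ i)))
    (trans (cong (lookup (allFin n)) (Fin.cast-involutive (sym len) len _))
           (sym (Perm.onIndices-lookup xs↭ (cast eq i))))

  mono : ∀ {i j} → i ≤ j → f (π ⟨$⟩ʳ i) ℕ.≤ f (π ⟨$⟩ʳ j)
  mono {i} {j} i≤j rewrite π-lookup i | π-lookup j =
    lookup-mono-≤ totalOrder (sort-↗ (allFin n))
      (subst₂ ℕ._≤_ (sym (Fin.toℕ-cast eq i)) (sym (Fin.toℕ-cast eq j)) i≤j)

-- Convexity for the preorder given by `f` passes to every linear order refining it, so ties may be
-- broken arbitrarily.
convex⇒C1P : ∀ {I : Set} {F : I → Subset n} (f : Fin n → ℕ) →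
             (∀ i → Convex (λ x y → f x ℕ.≤ f y) (_∈ F i)) → C1P F
convex⇒C1P f convex with π , mono ← sortBy f =
  π , λ i j k l j≤k k≤l → convex i (mono j≤k) (mono k≤l)

C1P⇒convex : ∀ {I : Set} {F : I → Subset n} → C1P F →
             ∃[ T ] Total T × (∀ i → Convex T (_∈ F i))
C1P⇒convex {n} {F = F} (π , consecutive) =
  (λ x y → π ⟨$⟩ˡ x ≤ π ⟨$⟩ˡ y) , (λ x y → Fin.≤-total (π ⟨$⟩ˡ x) (π ⟨$⟩ˡ y)) ,
  λ i x≤y y≤z x∈ z∈ → subst (_∈ F i) (inverseʳ π)
    (consecutive i _ _ _ x≤y y≤z (subst (_∈ F i) (sym (inverseʳ π)) x∈)
                                 (subst (_∈ F i) (sym (inverseʳ π)) z∈))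

-- Success of the swap partitioning and convex rows

module _ {n} (choose : ℕ → Side) {R : Subset n} {Rs : List (Subset n)}
         (ordered : SwapOrdered [ R ] Rs) where

  swapPartitioning-sound : ∀ {P} → swapPartitioning choose (R ∷ Rs) ≡ just P →
    ∃[ f ] All (λ A → Convex (λ x y → f x ℕ.≤ f y) (_∈ A)) (R ∷ Rs)
  swapPartitioning-sound {P} eq
    with Rs′ , chain , perm , run ← unswap choose [ R ] Rs ordered
    with d , snd ← refineAll-sound choose 1 (represents-singleton R) chain
                     (trans (sym (run (R ∷⁺ []))) eq) =
    -- The elements are ordered by the index of their part in the final partition.
    rank P , All-resp-↭ (↭-trans (↭-sym (∷↭∷ʳ R Rs′)) (prep R (↭-sym perm)))
                        (snd (rank-compatible d))

  swapPartitioning-succeeds : Total T → All (λ A → Convex T (_∈ A)) (R ∷ Rs) →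
    ∃[ P ] swapPartitioning choose (R ∷ Rs) ≡ just P
  swapPartitioning-succeeds total (convex ∷ convexes)
    with Rs′ , chain , perm , run ← unswap choose [ R ] Rs ordered =
    map₂ (trans (run (R ∷⁺ [])))
      (refineAll-succeeds choose 1 (represents-singleton R) chain total
        (compatible-singleton R convex) (All-resp-↭ perm convexes))

theorem1 : ∀ {n m : ℕ} (rows : Vector (Subset n) m) (K : Subset m) →
    OverlapClass rows K →
    (order : List (Fin m)) → SwapOverlapOrder rows K order →
    (choose : ℕ → Side) →
    Fails (swapPartitioning choose (map rows order)) ⇔ (¬ ClassC1P rows K)
theorem1 rows K (i , class) [] swapOrder choose =
  -- An overlap class contains its base row `i`, so its enumeration is not empty.
  contradiction (Equivalence.from (SwapOverlapOrder.enumerates swapOrder i)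
                  (Equivalence.from (class i) ε)) λ ()
theorem1 {n} {m} rows K _ order@(r ∷ rs) swapOrder choose = mk⇔ fails⇒¬C1P ¬C1P⇒fails
  where
  open SwapOverlapOrder swapOrder using (enumerates; overlapping)

  result : Maybe (Partition n)
  result = swapPartitioning choose (map rows order)

  ordered : SwapOrdered [ rows r ] (map rows rs)
  ordered = admissible⇒swapOrdered rows rs λ l → admissible-tail rows
    (Sum.map inj₂ (λ (l⁺ , eq , e , o) → l⁺ , eq , inj₂ e , o) (overlapping (suc l) ℕ.z<s))

  fails⇒¬C1P : Fails result → ¬ ClassC1P rows K
  fails⇒¬C1P fails c1p with T , total , convex ← C1P⇒convex c1p
    with P , succeeds ← swapPartitioning-succeeds choose ordered total
           (All.map⁺ (All.tabulate λ {i} i∈ → λ {_} {_} {_} →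
             convex (i , Equivalence.to (enumerates i) i∈)))
    with () ← trans (sym fails) succeeds

  ¬C1P⇒fails : ¬ ClassC1P rows K → Fails result
  -- The result of the run can be inspected, so it is enough to refute success.
  ¬C1P⇒fails ¬c1p with result in eq
  ... | nothing = refl
  ... | just P with f , convex ← swapPartitioning-sound choose ordered eq =
    contradiction (convex⇒C1P f λ (i , i∈K) →
      All.lookup (All.map⁻ convex) (Equivalence.from (enumerates i) i∈K)) ¬c1p
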